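{- Let $n$ be a multiple of $5$. Consider the position of $n$-Sim in which the board is decomposed into $n/5$ disjoint drawn $K_5$'s: the $n$ vertices are partitioned into $n/5$ disjoint sets of size $5$, each of these sets carries a drawn $K_5$ on its vertices, every edge joining vertices in two different sets is uncoloured, and it is PI's turn to move. Then this position is a second-player (PII) win.
   Context: The game $n$-Sim: the board is the complete graph on $n$ vertices. Two players, PI and PII, alternately colour one previously uncoloured edge, PI moving first; PI colours edges green and PII colours edges red. The first player to complete a triangle all of whose edges are in his own colour loses (the game ends immediately). If all edges are coloured with no monochromatic triangle, the game is a draw (this cannot happen for $n\ge 6$). A position is a partial colouring of the edges by green and red containing no monochromatic triangle. The player to move is determined by the edge counts: PI moves if the numbers of green and red edges are equal, and PII moves if there is exactly one more green edge than red. A position is a "PII win" (respectively "PI win") if PII (respectively PI) has a winning strategy when play continues from that position. A "drawn $K_5$" on a set of five vertices is a colouring of all ten edges among them in which the five green edges form a 5-cycle and the five red edges form the complementary 5-cycle (this is the unique colouring of $K_5$ in two colours without a monochromatic triangle, up to isomorphism).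
   Formalization: The formal theorem assumes n ≥ 6 (so n ≥ 10): for n = 5 the position is a fully coloured board with no monochromatic triangle, and for n = 0 the board is empty, so in both cases the game is a draw rather than a PII win. -}

module Defs where

open import Data.Nat using (ℕ; suc)
open import Data.Nat.DivMod using (_/_; _mod_)
open import Data.Fin using (Fin; toℕ; _<?_; _≟_)
open import Data.List using (length; filter; cartesianProduct; allFin)
open import Data.Maybe using (Maybe; just; nothing)
import Data.Maybe.Properties as Maybe
open import Data.Product using (_×_; _,_; ∃-syntax)
open import Data.Sum using (_⊎_; inj₁; inj₂)
open import Function.Bundles using (_⇔_)
open import Function.Definitions using (Injective)
open import Level using (0ℓ)
open import Relation.Binary.Definitions using (DecidableEquality)
open import Relation.Binary.PropositionalEquality
  using (_≡_; _≢_; refl; sym; trans)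
open import Relation.Nullary using (¬_; Dec; yes; no; contradiction)
open import Relation.Nullary.Decidable using (_×-dec_; _⊎-dec_)
open import Relation.Unary using (Pred)

data Colour : Set where
  green red : Colour

data Player : Set where
  PI PII : Player

colourOf : Player → Colour
colourOf PI  = green
colourOf PII = red

opponent : Player → Player
opponent PI  = PII
opponent PII = PI

_≟ᶜ_ : DecidableEquality Colour
green ≟ᶜ green = yes refl
green ≟ᶜ red   = no λ ()
red   ≟ᶜ green = no λ ()
red   ≟ᶜ red   = yes refl

record Colouring (n : ℕ) : Set where
  field
    colour   : Fin n → Fin n → Maybe Colour
    symm     : ∀ u v → colour u v ≡ colour v u
    loopless : ∀ v → colour v v ≡ nothing

open Colouring public

-- The three vertices are automatically distinct, since loops are uncoloured.
MonoTriangle : ∀ {n} → Colouring n → Colour → Set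
MonoTriangle c x = ∃[ u ] ∃[ v ] ∃[ w ]
  colour c u v ≡ just x × colour c v w ≡ just x × colour c u w ≡ just x

-- Each edge {u , v} is counted once, as the pair with u < v.
edgeCount : ∀ {n} → Colouring n → Colour → ℕ
edgeCount {n} c x = length (filter
  (λ (u , v) → (u <? v) ×-dec Maybe.≡-dec _≟ᶜ_ (colour c u v) (just x))
  (cartesianProduct (allFin n) (allFin n)))

HasTurn : ∀ {n} → Colouring n → Player → Set
HasTurn c PI  = edgeCount c green ≡ edgeCount c red
HasTurn c PII = edgeCount c green ≡ suc (edgeCount c red)

record Position (n : ℕ) : Set where
  field
    colouring  : Colouring n
    noTriangle : ∀ x → ¬ MonoTriangle colouring x
    toMove     : Player
    turn       : HasTurn colouring toMove

open Position public

record Move {n : ℕ} (c : Colouring n) : Set where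
  constructor edge
  field
    {src tgt}  : Fin n
    distinct   : src ≢ tgt
    uncoloured : colour c src tgt ≡ nothing

SameEdge : ∀ {n} → Fin n → Fin n → Fin n → Fin n → Set
SameEdge a b u v = (u ≡ a × v ≡ b) ⊎ (u ≡ b × v ≡ a)

sameEdge? : ∀ {n} (a b u v : Fin n) → Dec (SameEdge a b u v)
sameEdge? a b u v =
  ((u ≟ a) ×-dec (v ≟ b)) ⊎-dec ((u ≟ b) ×-dec (v ≟ a))

SameEdge-swap : ∀ {n} {a b u v : Fin n} → SameEdge a b u v → SameEdge a b v u
SameEdge-swap (inj₁ (p , q)) = inj₂ (q , p)
SameEdge-swap (inj₂ (p , q)) = inj₁ (q , p)

SameEdge-loop : ∀ {n} {a b v : Fin n} → SameEdge a b v v → a ≡ b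
SameEdge-loop (inj₁ (p , q)) = trans (sym p) q
SameEdge-loop (inj₂ (p , q)) = trans (sym q) p

play : ∀ {n} (c : Colouring n) → Move c → Colour → Colouring n
play {n} c m x = record
  { colour = colour′ ; symm = symm′ ; loopless = loopless′ }
  where
  open Move m renaming (src to a; tgt to b)

  colour′ : Fin n → Fin n → Maybe Colour
  colour′ u v with sameEdge? a b u v
  ... | yes _ = just x
  ... | no  _ = colour c u v

  symm′ : ∀ u v → colour′ u v ≡ colour′ v u
  symm′ u v with sameEdge? a b u v | sameEdge? a b v u
  ... | yes _ | yes _ = refl
  ... | yes p | no ¬q = contradiction (SameEdge-swap p) ¬q
  ... | no ¬p | yes q = contradiction (SameEdge-swap q) ¬p
  ... | no _  | no _  = symm c u v

  loopless′ : ∀ v → colour′ v v ≡ nothing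
  loopless′ v with sameEdge? a b v v
  ... | yes p = contradiction (SameEdge-loop p) distinct
  ... | no  _ = loopless c v

-- Wins W P c: player W has a winning strategy from the colouring c with P to
-- move.  A player completing a triangle in their own colour loses at once, so
-- W has to avoid this, while play continues after a move of the opponent only
-- if it completes no such triangle.  A fully coloured board is a draw, hence
-- a win for neither player: this is why `wait` asks for an available move.
data Wins {n : ℕ} (W : Player) : Player → Colouring n → Set where
  move : ∀ {c} (m : Move c) →
         let c′ = play c m (colourOf W) in
         ¬ MonoTriangle c′ (colourOf W) →
         Wins W (opponent W) c′ →
         Wins W W c
  wait : ∀ {c} →
         Move c →
         (∀ (m : Move c) →
          let c′ = play c m (colourOf (opponent W)) in
          ¬ MonoTriangle c′ (colourOf (opponent W)) →
          Wins W W c′) →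
         Wins W (opponent W) c

IsWin : ∀ {n} → Player → Position n → Set
IsWin W p = Wins W (toMove p) (colouring p)

next : Fin 5 → Fin 5
next i = suc (toℕ i) mod 5

-- S consists of the five vertices cycle 0, …, cycle 4.  The green edges on S
-- form the 5-cycle i ~ i + 1 (mod 5), and the other five edges, which form
-- the complementary 5-cycle i ~ i + 2 (mod 5), are red.
record DrawnK₅ {n : ℕ} (c : Colouring n) (S : Pred (Fin n) 0ℓ) : Set where
  field
    cycle      : Fin 5 → Fin n
    injective  : Injective _≡_ _≡_ cycle
    enumerates : ∀ v → S v ⇔ (∃[ i ] cycle i ≡ v)
    greenCycle : ∀ i → colour c (cycle i) (cycle (next i)) ≡ just green
    redCycle   : ∀ i → colour c (cycle i) (cycle (next (next i))) ≡ just red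

-- The parts of the partition are the fibres of `part`; each is nonempty, of
-- size 5, because it carries a drawn K₅.
record DrawnK₅Decomposition {n : ℕ} (c : Colouring n) : Set where
  field
    part  : Fin n → Fin (n / 5)
    drawn : ∀ k → DrawnK₅ c (λ v → part v ≡ k)
    cross : ∀ u v → part u ≢ part v → colour c u v ≡ nothing

{-# OPTIONS --safe #-}
module Submission where

open import Defs
open import Data.Nat using (ℕ; _≤_)
open import Data.Nat.Divisibility using (_∣_)
open import Relation.Binary.PropositionalEquality using (_≡_)

open import Data.Fin using (Fin; suc; toℕ; inject≤; _≟_)
open import Data.Fin.Patterns
open import Data.Fin.Permutation as Permutation
  using (Permutation′; permutation; _⟨$⟩ʳ_; _⟨$⟩ˡ_)
open import Data.Fin.Properties using (all?; any?; inject≤-injective; sequence; suc-injective)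
open import Data.List using (List; length; filter; cartesianProduct; allFin)
open import Data.List.Membership.Propositional using (_∈_; lose)
open import Data.List.Membership.Propositional.Properties
  using (∈-allFin; ∈-cartesianProduct⁺; ∈-filter⁺)
open import Data.List.Properties using (filter-notAll)
open import Data.Maybe as Maybe using (Maybe; just; nothing)
open import Data.Maybe.Properties as Maybe using (just-injective; map-id)
open import Data.Nat using (_+_; _*_; _<_)
open import Data.Nat.DivMod using (_/_; _mod_)
open import Data.Nat.Induction using (Acc; acc; <-wellFounded)
open import Data.Product using (∃-syntax; _×_; _,_; proj₁; proj₂)
open import Data.Product.Properties using (≡-dec)
open import Data.Sum as Sum using (_⊎_; inj₁; inj₂)
import Data.Sum.Effectful.Left as Left
open import Data.Vec using (lookup; tabulate; []; _∷_)
open import Data.Vec.Properties using (lookup∘tabulate)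
open import Function using (_∘_; id; Equivalence; Injective)
open import Level using (0ℓ)
open import Relation.Binary.PropositionalEquality
  using (_≢_; refl; sym; trans; cong; cong₂; subst; module ≡-Reasoning)
open import Relation.Nullary using (¬_; Dec; yes; no; contradiction)
open import Relation.Nullary.Decidable using (¬?; _×-dec_; _⊎-dec_; map′; from-yes)

-- Strategy stealing.  By Ramsey's theorem for K₆ the game has no draws, so it
-- suffices to turn a win of PI after the opening e = {u , v} into a win of PII
-- from the same position.  Maps i ↦ 2 i + s (mod 5) on the blocks, with s chosen
-- for each block, exchange green and red; one such symmetry fixes v and moves u
-- to a green neighbour u′.  Hence PII wins from the position with only {u′ , v}
-- added in red and PI to move, in particular when PI replies e.  But with e and
-- {u , u′} green, PI can never take {u′ , v} anyway: PII does not need to have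
-- coloured it, and wins after e alone.

-- Elementary facts on colours, triangles and edges.

_≟ᵐ_ : (x y : Maybe Colour) → Dec (x ≡ y)
_≟ᵐ_ = Maybe.≡-dec _≟ᶜ_

monoTriangle? : ∀ {n} (c : Colouring n) x → Dec (MonoTriangle c x)
monoTriangle? c x = any? λ u → any? λ v → any? λ w →
  (colour c u v ≟ᵐ just x) ×-dec (colour c v w ≟ᵐ just x) ×-dec (colour c u w ≟ᵐ just x)

TriangleFree : ∀ {n} → Colouring n → Set
TriangleFree c = ∀ x → ¬ MonoTriangle c x

just≢nothing : ∀ {m : Maybe Colour} {x} → m ≡ just x → m ≢ nothing
just≢nothing refl ()

coloured⇒distinct : ∀ {n} (c : Colouring n) {u v x} → colour c u v ≡ just x → u ≢ v
coloured⇒distinct c {u} uv refl = just≢nothing uv (loopless c u)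

opponent-involutive : ∀ P → opponent (opponent P) ≡ P
opponent-involutive PI  = refl
opponent-involutive PII = refl

SameEdge-map : ∀ {m n a b u v} (f : Fin m → Fin n) →
  SameEdge a b u v → SameEdge (f a) (f b) (f u) (f v)
SameEdge-map f (inj₁ (refl , refl)) = inj₁ (refl , refl)
SameEdge-map f (inj₂ (refl , refl)) = inj₂ (refl , refl)

SameEdge-injective : ∀ {m n a b u v} {f : Fin m → Fin n} → Injective _≡_ _≡_ f →
  SameEdge (f a) (f b) (f u) (f v) → SameEdge a b u v
SameEdge-injective inj (inj₁ (p , q)) = inj₁ (inj p , inj q)
SameEdge-injective inj (inj₂ (p , q)) = inj₂ (inj p , inj q)

-- Playing a move

module _ {n} (c : Colouring n) (m : Move c) where
  open Move m

  uncoloured-same : ∀ {u v} → SameEdge src tgt u v → colour c u v ≡ nothing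
  uncoloured-same (inj₁ (refl , refl)) = uncoloured
  uncoloured-same (inj₂ (refl , refl)) = trans (symm c tgt src) uncoloured

  play-same : ∀ {u v} x → SameEdge src tgt u v → colour (play c m x) u v ≡ just x
  play-same {u} {v} x e with sameEdge? src tgt u v
  ... | yes _ = refl
  ... | no ¬e = contradiction e ¬e

  play-other : ∀ {u v} x → ¬ SameEdge src tgt u v → colour (play c m x) u v ≡ colour c u v
  play-other {u} {v} x ¬e with sameEdge? src tgt u v
  ... | yes e = contradiction e ¬e
  ... | no _  = refl

  play-coloured : ∀ {u v y} x → colour c u v ≡ just y → colour (play c m x) u v ≡ just y
  play-coloured x uv = trans (play-other x λ e → just≢nothing uv (uncoloured-same e)) uv

  play-uncoloured : ∀ {u v} x → colour (play c m x) u v ≡ nothing → colour c u v ≡ nothing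
  play-uncoloured {u} {v} x uv with colour c u v in eq
  ... | nothing = refl
  ... | just _  = contradiction uv (just≢nothing (play-coloured x eq))

  play-reflects : ∀ {u v y} x → y ≢ x → colour (play c m x) u v ≡ just y → colour c u v ≡ just y
  play-reflects {u} {v} x y≢x uv with sameEdge? src tgt u v
  ... | yes _ = contradiction (sym (just-injective uv)) y≢x
  ... | no _  = uv

-- The move adds a single edge, of colour `x`, so a triangle in the other colour was there before.
play-triangleFree : ∀ {n} {c : Colouring n} (m : Move c) {x} →
  TriangleFree c → ¬ MonoTriangle (play c m x) x → TriangleFree (play c m x)
play-triangleFree {c = c} m {x} free safe y t@(u , v , w , uv , vw , uw) with y ≟ᶜ x
... | yes refl = safe t
... | no y≢x   = free y (u , v , w , reflect uv , reflect vw , reflect uw)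
  where
  reflect : ∀ {a b} → colour (play c m x) a b ≡ just y → colour c a b ≡ just y
  reflect = play-reflects c m x y≢x

-- Simulation

-- Abstracts over colour reversal and the identity, so that one simulation argument serves both the
-- symmetry of the board and the removal of useless edges.
record Relabelling : Set where
  field
    player          : Player → Player
    hue             : Colour → Colour
    hue-injective   : Injective _≡_ _≡_ hue
    player-opponent : ∀ P → player (opponent P) ≡ opponent (player P)
    hue-colourOf    : ∀ P → hue (colourOf P) ≡ colourOf (player P)

identity : Relabelling
identity = record
  { player = id ; hue = id ; hue-injective = id
  ; player-opponent = λ _ → refl ; hue-colourOf = λ _ → refl }

flip : Colour → Colour
flip green = red
flip red   = green

reversal : Relabelling
reversal = record
  { player = opponent ; hue = flip
  ; hue-injective = λ { {green} {green} _ → refl ; {red} {red} _ → refl }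
  ; player-opponent = λ _ → refl
  ; hue-colourOf = λ { PI → refl ; PII → refl } }

Blocked : ∀ {n} → Colouring n → Colour → Fin n → Fin n → Set
Blocked c x u v = ∃[ w ] colour c u w ≡ just x × colour c w v ≡ just x

module Simulation {n} (π : Permutation′ n) (ρ : Relabelling) (W : Player) where
  open Relabelling ρ

  private
    W′ = player W
    x̄  = colourOf (opponent W)
    x̄′ = hue x̄

    to from : Fin n → Fin n
    to   = π ⟨$⟩ʳ_
    from = π ⟨$⟩ˡ_

    to-from : ∀ v → to (from v) ≡ v
    to-from v = Permutation.inverseʳ π

    to-injective : Injective _≡_ _≡_ to
    to-injective eq =
      trans (sym (Permutation.inverseˡ π)) (trans (cong from eq) (Permutation.inverseˡ π))

  Related : (c d : Colouring n) → Fin n → Fin n → Set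
  Related c d u v =
    colour c (to u) (to v) ≡ Maybe.map hue (colour d u v)
    ⊎ (colour c (to u) (to v) ≡ nothing × colour d u v ≡ just (colourOf W)
       × Blocked c x̄′ (to u) (to v))

  -- Up to the renaming, d arises from c by giving W some further edges which
  -- are useless to the opponent in c: taking one would complete a triangle.
  record _≼_ (c d : Colouring n) : Set where
    constructor ≼-by
    field
      relate : ∀ u v → Related c d u v

  open _≼_

  module _ {c d} (c≼d : c ≼ d) where

    uncoloured-image : ∀ {u v} → colour d u v ≡ nothing → colour c (to u) (to v) ≡ nothing
    uncoloured-image {u} {v} uv with relate c≼d u v
    ... | inj₁ eq       = trans eq (cong (Maybe.map hue) uv)
    ... | inj₂ (eq , _) = eq

    image : Move d → Move c
    image (edge u≢v uv) = edge (u≢v ∘ to-injective) (uncoloured-image uv)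

    -- An edge coloured in `c` falls under the first alternative of `Related`, since the extra edges
    -- of `d` are uncoloured in `c`. Hence triangles of `c` pull back to `d`, which keeps the moves
    -- of `W` safe.
    reflect-colour : ∀ {u v x} → colour c (to u) (to v) ≡ just (hue x) → colour d u v ≡ just x
    reflect-colour {u} {v} uv with colour d u v | relate c≼d u v
    ... | nothing | inj₁ eq with () ← trans (sym uv) eq
    ... | just _  | inj₁ eq = cong just (hue-injective (just-injective (trans (sym eq) uv)))
    ... | _       | inj₂ (eq , _) with () ← trans (sym uv) eq

    reflect-triangle : ∀ {x} → MonoTriangle c (hue x) → MonoTriangle d x
    reflect-triangle {x} (u , v , w , uv , vw , uw) =
      from u , from v , from w , reflect uv , reflect vw , reflect uw
      where
      reflect : ∀ {a b} → colour c a b ≡ just (hue x) → colour d (from a) (from b) ≡ just x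
      reflect {a} {b} ab = reflect-colour (trans (cong₂ (colour c) (to-from a) (to-from b)) ab)

    -- The extra edges carry the colour of `W`, so a triangle of the opponent contains none of them.
    -- It serves to show that a reply safe in `c` is also safe in `d`.
    preserve-triangle : MonoTriangle d x̄ → MonoTriangle c x̄′
    preserve-triangle (u , v , w , uv , vw , uw) =
      to u , to v , to w , preserve uv , preserve vw , preserve uw
      where
      colourOf-opponent : ∀ P → colourOf P ≢ colourOf (opponent P)
      colourOf-opponent PI ()
      colourOf-opponent PII ()

      preserve : ∀ {a b} → colour d a b ≡ just x̄ → colour c (to a) (to b) ≡ just x̄′
      preserve {a} {b} ab with relate c≼d a b
      ... | inj₁ eq = trans eq (cong (Maybe.map hue) ab)
      ... | inj₂ (_ , eq , _) =
        contradiction (just-injective (trans (sym eq) ab)) (colourOf-opponent W)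

    -- The new edge matches on both sides, and colours are never erased, so blocking paths survive.
    -- The ends are compared by equations because a move may be carried forward by `to` or back by
    -- `from`.
    play-≼ : (m : Move d) (m′ : Move c) →
      to (Move.src m) ≡ Move.src m′ → to (Move.tgt m) ≡ Move.tgt m′ →
      ∀ {x y} → hue x ≡ y → play c m′ y ≼ play d m x
    play-≼ m m′ refl refl {x} refl = ≼-by related
      where
      related : ∀ u v → Related (play c m′ (hue x)) (play d m x) u v
      related u v with sameEdge? (Move.src m) (Move.tgt m) u v
      ... | yes e = inj₁ (play-same c m′ (hue x) (SameEdge-map to e))
      ... | no ¬e = Sum.map (trans unchanged)
        (λ (uv , duv , w , uw , wv) → trans unchanged uv , duv ,
          w , play-coloured c m′ (hue x) uw , play-coloured c m′ (hue x) wv)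
        (relate c≼d u v)
        where
        unchanged = play-other c m′ (hue x) (¬e ∘ SameEdge-injective to-injective)

  hue-opponent : x̄′ ≡ colourOf (opponent W′)
  hue-opponent = trans (hue-colourOf (opponent W)) (cong colourOf (player-opponent W))

  -- `W` follows the strategy for `d` through the renaming. The opponent gains nothing in `c`: the
  -- only additional edges on offer there are blocked, and taking one loses at once.
  simulate : ∀ {P c d} → c ≼ d → Wins W P d → Wins W′ (player P) c
  simulate {c = c} c≼d (move m safe win) =
    move (image c≼d m)
      (λ t → safe (reflect-triangle next≼ (subst (MonoTriangle c′) (sym (hue-colourOf W)) t)))
      (subst (λ P → Wins W′ P c′) (player-opponent W) (simulate next≼ win))
    where
    c′    = play c (image c≼d m) (colourOf W′)
    next≼ = play-≼ c≼d m (image c≼d m) refl refl (hue-colourOf W)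
  simulate {c = c} {d} c≼d (wait m₀ win) =
    subst (λ P → Wins W′ P c) (sym (player-opponent W)) (wait (image c≼d m₀) reply)
    where
    reply : ∀ m → let c′ = play c m (colourOf (opponent W′)) in
            ¬ MonoTriangle c′ (colourOf (opponent W′)) → Wins W′ W′ c′
    reply m@(edge {a} {b} a≢b ab) safe
      with colour d (from a) (from b) in eq | relate c≼d (from a) (from b)
    ... | nothing | _ = simulate next≼ (win preimage λ t →
          safe (subst (MonoTriangle (play c m (colourOf (opponent W′)))) hue-opponent
                 (preserve-triangle next≼ t)))
      where
      preimage : Move d
      preimage = edge (λ p → a≢b (trans (sym (to-from a)) (trans (cong to p) (to-from b)))) eq
      next≼ = play-≼ c≼d preimage m (to-from a) (to-from b) hue-opponent
    ... | just _ | inj₁ uv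
      with () ← trans (sym uv) (trans (cong₂ (colour c) (to-from a) (to-from b)) ab)
    -- An extra edge of `d`: the new edge closes a triangle with the blocking path through `w`, so
    -- this reply was not safe.
    ... | just _ | inj₂ (_ , _ , w , aw , wb) = contradiction
          (a , w , b , keep (recolour (to-from a) refl aw) , keep (recolour refl (to-from b) wb)
          , play-same c m _ (inj₁ (refl , refl))) safe
      where
      recolour : ∀ {p q r s} → p ≡ q → r ≡ s → colour c p r ≡ just x̄′ →
                 colour c q s ≡ just (colourOf (opponent W′))
      recolour refl refl pr = trans pr (cong just hue-opponent)
      keep : ∀ {p q y} → colour c p q ≡ just y →
             colour (play c m (colourOf (opponent W′))) p q ≡ just y
      keep = play-coloured c m (colourOf (opponent W′))

-- Determinacy

allColours? : ∀ {P : Colour → Set} → (∀ x → Dec (P x)) → Dec (∀ x → P x)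
allColours? P? = map′ (λ { (g , r) green → g ; (g , r) red → r })
  (λ f → f green , f red) (P? green ×-dec P? red)

abstract
  -- The pigeonhole step of Ramsey's argument, checked on all 32 cases. The colours are separate
  -- arguments so that they can be enumerated.
  three-of-five : ∀ (a b c d e : Colour) → let f = lookup (a ∷ b ∷ c ∷ d ∷ e ∷ []) in
    ∃[ i ] ∃[ j ] ∃[ k ] (i ≢ j × f i ≡ f j) × (i ≢ k × j ≢ k) × f j ≡ f k
  three-of-five = from-yes
    (allColours? λ a → allColours? λ b → allColours? λ c → allColours? λ d → allColours? λ e →
     let f = lookup (a ∷ b ∷ c ∷ d ∷ e ∷ []) in
     any? λ i → any? λ j → any? λ k →
     (¬? (i ≟ j) ×-dec f i ≟ᶜ f j) ×-dec (¬? (i ≟ k) ×-dec ¬? (j ≟ k)) ×-dec (f j ≟ᶜ f k))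

≢⇒flip : ∀ {x y} → y ≢ x → y ≡ flip x
≢⇒flip {green} {green} y≢x = contradiction refl y≢x
≢⇒flip {green} {red}   _   = refl
≢⇒flip {red}   {green} _   = refl
≢⇒flip {red}   {red}   y≢x = contradiction refl y≢x

-- Three of the five edges from one vertex share a colour. Either an edge between their ends has
-- this colour too and closes a triangle, or the three ends span a triangle in the other colour.
ramsey : ∀ {n} → 6 ≤ n → (c : Colouring n) →
  (∀ {u v} → u ≢ v → ∃[ x ] colour c u v ≡ just x) → ∃[ x ] MonoTriangle c x
ramsey {n} 6≤n c total = monochromatic
  where
  vertex : Fin 6 → Fin n
  vertex i = inject≤ i 6≤n

  distinct : ∀ {i j} → i ≢ j → vertex i ≢ vertex j
  distinct i≢j eq = i≢j (inject≤-injective 6≤n 6≤n _ _ eq)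

  spoke : ∀ i → ∃[ x ] colour c (vertex 0F) (vertex (suc i)) ≡ just x
  spoke i = total (distinct λ ())

  -- Passing through a vector makes this agree by computation with the function in `three-of-five`.
  hue : Fin 5 → Colour
  hue = lookup (tabulate (proj₁ ∘ spoke))

  hued : ∀ i → colour c (vertex 0F) (vertex (suc i)) ≡ just (hue i)
  hued i = trans (proj₂ (spoke i)) (cong just (sym (lookup∘tabulate (proj₁ ∘ spoke) i)))

  monochromatic : ∃[ x ] MonoTriangle c x
  monochromatic with three-of-five (proj₁ (spoke 0F)) (proj₁ (spoke 1F))
                       (proj₁ (spoke 2F)) (proj₁ (spoke 3F)) (proj₁ (spoke 4F))
  ... | i , j , k , (i≢j , ij) , (i≢k , j≢k) , jk
    with total (distinct (i≢j ∘ suc-injective)) | total (distinct (j≢k ∘ suc-injective))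
       | total (distinct (i≢k ∘ suc-injective))
  ... | x , x-ij | y , y-jk | z , z-ik with x ≟ᶜ hue j | y ≟ᶜ hue j | z ≟ᶜ hue j
  ... | yes refl | _ | _ =
    _ , _ , _ , _ , trans (hued i) (cong just ij) , x-ij , hued j
  ... | no _ | yes refl | _ =
    _ , _ , _ , _ , hued j , y-jk , trans (hued k) (cong just (sym jk))
  ... | no _ | no _ | yes refl =
    _ , _ , _ , _ , trans (hued i) (cong just ij) , z-ik , trans (hued k) (cong just (sym jk))
  ... | no x≢ | no y≢ | no z≢ =
    _ , _ , _ , _ , trans x-ij (cong just (≢⇒flip x≢)) , trans y-jk (cong just (≢⇒flip y≢))
      , trans z-ik (cong just (≢⇒flip z≢))

-- By `ramsey` a full board has a monochromatic triangle. This excludes draws and supplies the move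
-- that `wait` demands.
available-move : ∀ {n} → 6 ≤ n → (c : Colouring n) → TriangleFree c → Move c
available-move 6≤n c free
  with any? (λ u → any? λ v → ¬? (u ≟ v) ×-dec (colour c u v ≟ᵐ nothing))
... | yes (_ , _ , u≢v , uv) = edge u≢v uv
... | no none = contradiction (proj₂ mono) (free (proj₁ mono))
  where
  total : ∀ {u v} → u ≢ v → ∃[ x ] colour c u v ≡ just x
  total {u} {v} u≢v with colour c u v in uv
  ... | just x  = x , refl
  ... | nothing = contradiction (u , v , u≢v , uv) none

  mono = ramsey 6≤n c total

≼-refl : ∀ {n} {W} (c : Colouring n) → Simulation._≼_ Permutation.id identity W c c
≼-refl c = Simulation.≼-by λ u v → inj₁ (sym (map-id (colour c u v)))

module Determinacy {n} (6≤n : 6 ≤ n) where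

  -- Splitting on `P` lets `opponent (opponent P)` reduce to `P`, as the type of `wait` requires.
  wait′ : ∀ P {c : Colouring n} → Move c →
    (∀ (m : Move c) → let c′ = play c m (colourOf P) in
     ¬ MonoTriangle c′ (colourOf P) → Wins (opponent P) (opponent P) c′) →
    Wins (opponent P) P c
  wait′ PI  = wait
  wait′ PII = wait

  -- Backward induction as in Zermelo's theorem. The list `edges` bounds the remaining moves from
  -- above, and each move deletes its own pair from it.
  determined-below : ∀ (edges : List (Fin n × Fin n)) → Acc _<_ (length edges) →
    ∀ c → TriangleFree c → (∀ (m : Move c) → (Move.src m , Move.tgt m) ∈ edges) →
    ∀ P → Wins P P c ⊎ Wins (opponent P) P c
  determined-below edges (acc rec) c free covers P =
    Sum.map₂ (λ avoid → wait′ P (available-move 6≤n c free)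
               λ m safe → avoid (Move.src m) (Move.tgt m) m refl refl safe)
      -- Sequencing in the sum applicative either stops at a winning move for `P` or collects a
      -- refutation for every pair. It runs over pairs of vertices, which are finitely many, rather
      -- than over moves, which contain proofs.
      (sequence ⊎-applicative λ u → sequence ⊎-applicative λ v → try u v)
    where
    ⊎-applicative = Left.applicative (Wins P P c) 0ℓ

    Avoids : Fin n → Fin n → Set
    Avoids u v = ∀ m → Move.src m ≡ u → Move.tgt m ≡ v → let c′ = play c m (colourOf P) in
                 ¬ MonoTriangle c′ (colourOf P) → Wins (opponent P) (opponent P) c′

    -- Moves with the same ends may still carry different proofs.
    coincide : ∀ {W} (m m′ : Move c) → Move.src m ≡ Move.src m′ → Move.tgt m ≡ Move.tgt m′ →
      Simulation._≼_ Permutation.id identity W (play c m (colourOf P)) (play c m′ (colourOf P))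
    coincide m m′ p q = Simulation.play-≼ _ _ _ (≼-refl c) m′ m (sym p) (sym q) refl

    try : ∀ u v → Wins P P c ⊎ Avoids u v
    try u v with u ≟ v | colour c u v ≟ᵐ nothing
    ... | yes u≡v | _     = inj₂ λ m → λ { refl refl → contradiction u≡v (Move.distinct m) }
    ... | no _    | no uv = inj₂ λ m → λ { refl refl → contradiction (Move.uncoloured m) uv }
    ... | no u≢v  | yes uv with monoTriangle? (play c (edge u≢v uv) (colourOf P)) (colourOf P)
    ... | yes t = inj₂ λ m → λ { refl refl safe → contradiction
            (Simulation.reflect-triangle _ _ PI (coincide (edge u≢v uv) m refl refl) t) safe }
    -- The induction hypothesis decides the position after this move. A win for `P` makes it a
    -- winning move; a win for the opponent carries over to all moves with the same ends.
    ... | no safe =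
      Sum.map (move m₀ safe ∘ subst (λ Q → Wins Q (opponent P) c₀) (opponent-involutive P))
        (λ win m → λ { refl refl _ → Simulation.simulate _ _ _ (coincide m m₀ refl refl) win })
        (Sum.swap (determined-below remaining (rec shrink) c₀
                    (play-triangleFree m₀ free safe) covers₀ (opponent P)))
      where
      m₀ = edge u≢v uv
      c₀ = play c m₀ (colourOf P)

      other? : ∀ e → Dec (e ≢ (u , v))
      other? e = ¬? (≡-dec _≟_ _≟_ e (u , v))

      remaining = filter other? edges

      shrink : length remaining < length edges
      shrink = filter-notAll other? edges (lose (covers m₀) (λ ¬eq → ¬eq refl))

      covers₀ : ∀ (m : Move c₀) → (Move.src m , Move.tgt m) ∈ remaining
      covers₀ (edge a≢b ab) = ∈-filter⁺ other?
        (covers (edge a≢b (play-uncoloured c m₀ (colourOf P) ab)))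
        λ { refl → just≢nothing (play-same c m₀ (colourOf P) (inj₁ (refl , refl))) ab }

  determined : ∀ c → TriangleFree c → ∀ P → Wins P P c ⊎ Wins (opponent P) P c
  determined c free = determined-below (cartesianProduct (allFin n) (allFin n))
    (<-wellFounded _) c free λ m → ∈-cartesianProduct⁺ (∈-allFin _) (∈-allFin _)

-- The colour reversing symmetry

-- Nonzero differences modulo 5 are ±1 or ±2, so every edge of a block lies on its green or its red
-- cycle.
neighbours : ∀ i j → i ≡ j ⊎ (j ≡ next i ⊎ i ≡ next j) ⊎ (j ≡ next (next i) ⊎ i ≡ next (next j))
neighbours = from-yes (all? λ i → all? λ j →
  (i ≟ j) ⊎-dec ((j ≟ next i) ⊎-dec (i ≟ next j))
          ⊎-dec ((j ≟ next (next i)) ⊎-dec (i ≟ next (next j))))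

next⁵ : ∀ i → next (next (next (next (next i)))) ≡ i
next⁵ = from-yes (all? λ i → next (next (next (next (next i)))) ≟ i)

-- Mutually inverse affine maps modulo 5: 3 inverts 2, and `2 s` cancels the `3 s` coming from the
-- shift.
double halve : Fin 5 → Fin 5 → Fin 5
double s i = (2 * toℕ i + toℕ s) mod 5
halve  s i = (3 * toℕ i + 2 * toℕ s) mod 5

double-halve : ∀ s i → double s (halve s i) ≡ i
double-halve = from-yes (all? λ s → all? λ i → double s (halve s i) ≟ i)

halve-double : ∀ s i → halve s (double s i) ≡ i
halve-double = from-yes (all? λ s → all? λ i → halve s (double s i) ≟ i)

-- A step of one becomes a step of two, so green edges go to red ones. Applied twice, it turns a
-- step of two into one of four, that is, of minus one, so red edges go to green ones.
double-next : ∀ s i → double s (next i) ≡ next (next (double s i))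
double-next = from-yes (all? λ s → all? λ i → double s (next i) ≟ next (next (double s i)))

-- The solutions `s` of 2 i + s = i and of 2 i + s = i + 1 modulo 5, with 4 standing for -1.
fixing advancing : Fin 5 → Fin 5
fixing    i = (4 * toℕ i) mod 5
advancing i = (4 * toℕ i + 1) mod 5

double-fixing : ∀ i → double (fixing i) i ≡ i
double-fixing = from-yes (all? λ i → double (fixing i) i ≟ i)

double-advancing : ∀ i → double (advancing i) i ≡ next i
double-advancing = from-yes (all? λ i → double (advancing i) i ≟ next i)

-- Symmetries of a decomposition into drawn K₅'s.

module Decomposition {n} {c : Colouring n} (D : DrawnK₅Decomposition c) where
  open DrawnK₅Decomposition D
  open module Block k = DrawnK₅ (drawn k) using (cycle)

  index : Fin n → Fin 5
  index v = proj₁ (Equivalence.to (Block.enumerates (part v) v) refl)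

  cycle-index : ∀ v → cycle (part v) (index v) ≡ v
  cycle-index v = proj₂ (Equivalence.to (Block.enumerates (part v) v) refl)

  part-cycle : ∀ k i → part (cycle k i) ≡ k
  part-cycle k i = Equivalence.from (Block.enumerates k (cycle k i)) (i , refl)

  index-cycle : ∀ k i → index (cycle k i) ≡ i
  index-cycle k i = index-unique (part-cycle k i) refl
    where
    index-unique : ∀ {v k i} → part v ≡ k → cycle k i ≡ v → index v ≡ i
    index-unique {v} refl eq = Block.injective (part v) (trans (cycle-index v) (sym eq))

  inside : ∀ {P : Fin n → Fin n → Set} → (∀ k i j → P (cycle k i) (cycle k j)) →
    ∀ u v → part u ≡ part v → P u v
  inside {P} Pcycle u v eq = subst (λ w → P w v) (cycle-index u)
    (subst (P _) (trans (cong (λ k → cycle k (index v)) eq) (cycle-index v))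
      (Pcycle (part u) (index u) (index v)))

  -- By `neighbours` all edges within a block are coloured. Hence an opening move joins two blocks,
  -- whose shifts can be chosen independently.
  uncoloured⇒apart : ∀ {u v} → u ≢ v → colour c u v ≡ nothing → part u ≢ part v
  uncoloured⇒apart {u} {v} u≢v uv same =
    inside {λ u v → u ≢ v → colour c u v ≢ nothing} coloured u v same u≢v uv
    where
    coloured : ∀ k i j → cycle k i ≢ cycle k j → colour c (cycle k i) (cycle k j) ≢ nothing
    coloured k i j i≢j with neighbours i j
    ... | inj₁ refl = contradiction refl i≢j
    ... | inj₂ (inj₁ (inj₁ refl)) = just≢nothing (Block.greenCycle k i)
    ... | inj₂ (inj₁ (inj₂ refl)) = just≢nothing (trans (symm c _ _) (Block.greenCycle k j))
    ... | inj₂ (inj₂ (inj₁ refl)) = just≢nothing (Block.redCycle k i)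
    ... | inj₂ (inj₂ (inj₂ refl)) = just≢nothing (trans (symm c _ _) (Block.redCycle k j))

  blockwise : (Fin (n / 5) → Fin 5 → Fin 5) → Fin n → Fin n
  blockwise f v = cycle (part v) (f (part v) (index v))

  blockwise-cycle : ∀ f k i → blockwise f (cycle k i) ≡ cycle k (f k i)
  blockwise-cycle f k i = cong₂ (λ k i → cycle k (f k i)) (part-cycle k i) (index-cycle k i)

  blockwise-inverse : ∀ f g → (∀ k i → f k (g k i) ≡ i) → ∀ v → blockwise f (blockwise g v) ≡ v
  blockwise-inverse f g inv v = begin
    blockwise f (cycle k (g k (index v))) ≡⟨ blockwise-cycle f k _ ⟩
    cycle k (f k (g k (index v)))         ≡⟨ cong (cycle k) (inv k (index v)) ⟩
    cycle k (index v)                     ≡⟨ cycle-index v ⟩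
    v                                     ∎
    where
    open ≡-Reasoning
    k = part v

  module _ (shift : Fin (n / 5) → Fin 5) where

    twist : Permutation′ n
    twist = permutation (blockwise (double ∘ shift)) (blockwise (halve ∘ shift))
      (blockwise-inverse (double ∘ shift) (halve ∘ shift) (double-halve ∘ shift))
      (blockwise-inverse (halve ∘ shift) (double ∘ shift) (halve-double ∘ shift))

    Reversed : Fin n → Fin n → Set
    Reversed u v = colour c (twist ⟨$⟩ʳ u) (twist ⟨$⟩ʳ v) ≡ Maybe.map flip (colour c u v)

    reversed-sym : ∀ {u v} → Reversed u v → Reversed v u
    reversed-sym eq = trans (symm c _ _) (trans eq (cong (Maybe.map flip) (symm c _ _)))

    twist-cycle : ∀ k i → twist ⟨$⟩ʳ cycle k i ≡ cycle k (double (shift k) i)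
    twist-cycle = blockwise-cycle (double ∘ shift)

    green-reversed : ∀ k i → Reversed (cycle k i) (cycle k (next i))
    green-reversed k i = begin
      colour c (twist ⟨$⟩ʳ cycle k i) (twist ⟨$⟩ʳ cycle k (next i))
        ≡⟨ cong₂ (colour c) (twist-cycle k i)
             (trans (twist-cycle k (next i)) (cong (cycle k) (double-next (shift k) i))) ⟩
      colour c (cycle k (d i)) (cycle k (next (next (d i))))
        ≡⟨ Block.redCycle k (d i) ⟩
      just red
        ≡⟨ cong (Maybe.map flip) (Block.greenCycle k i) ⟨
      Maybe.map flip (colour c (cycle k i) (cycle k (next i))) ∎
      where
      open ≡-Reasoning
      d = double (shift k)

    red-reversed : ∀ k i → Reversed (cycle k i) (cycle k (next (next i)))
    red-reversed k i = begin
      colour c (twist ⟨$⟩ʳ cycle k i) (twist ⟨$⟩ʳ cycle k (next (next i)))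
        ≡⟨ cong₂ (colour c)
             -- The image of the second end is four steps ahead of `d i`. Writing `d i` as five
             -- steps ahead of itself exhibits a green edge, traversed backwards.
             (trans (twist-cycle k i) (cong (cycle k) (sym (next⁵ (d i)))))
             (trans (twist-cycle k (next (next i))) (cong (cycle k)
               (trans (double-next s (next i)) (cong (next ∘ next) (double-next s i))))) ⟩
      colour c (cycle k (next (next⁴ (d i)))) (cycle k (next⁴ (d i)))
        ≡⟨ symm c _ _ ⟩
      colour c (cycle k (next⁴ (d i))) (cycle k (next (next⁴ (d i))))
        ≡⟨ Block.greenCycle k (next⁴ (d i)) ⟩
      just green
        ≡⟨ cong (Maybe.map flip) (Block.redCycle k i) ⟨
      Maybe.map flip (colour c (cycle k i) (cycle k (next (next i)))) ∎
      where
      open ≡-Reasoning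
      s     = shift k
      d     = double s
      next⁴ = next ∘ next ∘ next ∘ next

    block-reversed : ∀ k i j → Reversed (cycle k i) (cycle k j)
    block-reversed k i j with neighbours i j
    ... | inj₁ refl = trans (loopless c _) (cong (Maybe.map flip) (sym (loopless c _)))
    ... | inj₂ (inj₁ (inj₁ refl)) = green-reversed k i
    ... | inj₂ (inj₁ (inj₂ refl)) = reversed-sym (green-reversed k j)
    ... | inj₂ (inj₂ (inj₁ refl)) = red-reversed k i
    ... | inj₂ (inj₂ (inj₂ refl)) = reversed-sym (red-reversed k j)

    -- Within a block the two cycles are exchanged. Each block is mapped to itself, so edges between
    -- blocks stay between blocks, where nothing is coloured.
    twist-reverses : ∀ u v → Reversed u v
    twist-reverses u v with part u ≟ part v
    ... | yes same = inside {Reversed} block-reversed u v same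
    ... | no apart = trans
      (cross _ _ λ eq → apart (trans (sym (part-cycle _ _)) (trans eq (part-cycle _ _))))
      (cong (Maybe.map flip) (sym (cross u v apart)))

  module _ {u v : Fin n} (apart : part u ≢ part v) where

    -- The block of `u` gets the shift advancing `u` along its green cycle; the constant used
    -- elsewhere fixes `v`, whose block is a different one by `apart`.
    shift : Fin (n / 5) → Fin 5
    shift k with k ≟ part u
    ... | yes _ = advancing (index u)
    ... | no _  = fixing (index v)

    τ : Permutation′ n
    τ = twist shift

    τ-source : τ ⟨$⟩ʳ u ≡ cycle (part u) (next (index u))
    τ-source with part u ≟ part u
    ... | yes _ = cong (cycle (part u)) (double-advancing (index u))
    ... | no ≢  = contradiction refl ≢

    τ-target : τ ⟨$⟩ʳ v ≡ v
    τ-target with part v ≟ part u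
    ... | yes eq = contradiction (sym eq) apart
    ... | no _   = trans (cong (cycle (part v)) (double-fixing (index v))) (cycle-index v)

    -- With `{u , v}` green as well, this edge gives the path that blocks PI from the image of the
    -- opening edge.
    τ-green : colour c (τ ⟨$⟩ʳ u) u ≡ just green
    τ-green = begin
      colour c (τ ⟨$⟩ʳ u) u
        ≡⟨ cong₂ (colour c) τ-source (sym (cycle-index u)) ⟩
      colour c (cycle (part u) (next (index u))) (cycle (part u) (index u))
        ≡⟨ symm c _ _ ⟩
      colour c (cycle (part u) (index u)) (cycle (part u) (next (index u)))
        ≡⟨ Block.greenCycle (part u) (index u) ⟩
      just green ∎
      where open ≡-Reasoning

-- The strategy-stealing argument.

module Stealing {n} (6≤n : 6 ≤ n) {c : Colouring n} (free : TriangleFree c)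
  (π : Permutation′ n)
  (reverses : ∀ a b → colour c (π ⟨$⟩ʳ a) (π ⟨$⟩ʳ b) ≡ Maybe.map flip (colour c a b))
  (e : Move c) (safe : ¬ MonoTriangle (play c e green) green)
  (source-green : colour c (π ⟨$⟩ʳ Move.src e) (Move.src e) ≡ just green)
  (target-fixed : π ⟨$⟩ʳ Move.tgt e ≡ Move.tgt e) where

  open Move e renaming (src to u; tgt to v)

  private
    module Reverse = Simulation {n} π reversal PI
    module Remove  = Simulation {n} Permutation.id identity PII

    reversed : c Reverse.≼ c
    reversed = Reverse.≼-by λ a b → inj₁ (reverses a b)

    πe : Move c
    πe = Reverse.image reversed e

    c-e c-πe : Colouring n
    c-e  = play c e green
    c-πe = play c πe red

    e≠πe : ¬ SameEdge (π ⟨$⟩ʳ u) (π ⟨$⟩ʳ v) u v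
    e≠πe (inj₁ (u≡πu , _)) = coloured⇒distinct c source-green (sym u≡πu)
    e≠πe (inj₂ (u≡πv , _)) = distinct (trans u≡πv target-fixed)

    e′ : Move c-πe
    e′ = edge distinct (trans (play-other c πe red e≠πe) uncoloured)

    d : Colouring n
    d = play c-πe e′ green

    -- The two colourings differ only in the edge `πe`, red in `d`. In `c-e` its ends are joined by
    -- a green path through `u`: one edge is `source-green`, the other is `e` itself, as `v` is
    -- fixed.
    removal : c-e Remove.≼ d
    removal = Remove.≼-by λ a b → related (sameEdge? u v a b) (sameEdge? (π ⟨$⟩ʳ u) (π ⟨$⟩ʳ v) a b)
      where
      blocked : ∀ {a b} → SameEdge (π ⟨$⟩ʳ u) (π ⟨$⟩ʳ v) a b → Blocked c-e green a b
      blocked (inj₁ (refl , refl)) =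
        u , play-coloured c e green source-green
          , play-same c e green (inj₁ (refl , target-fixed))
      blocked (inj₂ (refl , refl)) =
        u , play-same c e green (inj₂ (target-fixed , refl))
          , play-coloured c e green (trans (symm c _ _) source-green)

      related : ∀ {a b} → Dec (SameEdge u v a b) → Dec (SameEdge (π ⟨$⟩ʳ u) (π ⟨$⟩ʳ v) a b) →
                Remove.Related c-e d a b
      related (yes eq) _ =
        inj₁ (trans (play-same c e green eq)
                    (sym (cong (Maybe.map id) (play-same c-πe e′ green eq))))
      related (no ≢e) (yes eq) =
        inj₂ ( trans (play-other c e green ≢e) (uncoloured-same c πe eq)
             , trans (play-other c-πe e′ green ≢e) (play-same c πe red eq)
             , blocked eq)
      related (no ≢e) (no ≢πe) =
        inj₁ (trans (play-other c e green ≢e) (sym (trans (map-id _)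
             (trans (play-other c-πe e′ green ≢e) (play-other c πe red ≢πe)))))

    steal : Wins PI PII c-e → Wins PII PII c-e
    steal win with Reverse.simulate (Reverse.play-≼ reversed e πe refl refl refl) win
    -- The reversed win answers every safe reply of PI, in particular `e′`. This reply is safe
    -- because a green triangle in `d` avoids the red `πe` and so would already lie in `c-e`.
    ... | wait _ respond = Remove.simulate removal (respond e′ (safe ∘ Remove.preserve-triangle removal))

  second-player-wins : Wins PII PII c-e
  second-player-wins = Sum.[ id , steal ]′
    (Determinacy.determined 6≤n c-e (play-triangleFree e free safe) PII)

theorem1 : ∀ (n : ℕ) → 5 ∣ n → 6 ≤ n →
    (p : Position n) →
    DrawnK₅Decomposition (colouring p) →
    toMove p ≡ PI →
    IsWin PII p
theorem1 n _ 6≤n p D PI-moves = subst (λ P → Wins PII P c) (sym PI-moves)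
  (wait (available-move 6≤n c (noTriangle p)) λ e safe →
    let apart = uncoloured⇒apart (Move.distinct e) (Move.uncoloured e) in
    Stealing.second-player-wins 6≤n (noTriangle p) (τ apart) (twist-reverses (shift apart)) e safe
      (τ-green apart) (τ-target apart))
  where
  c = colouring p
  open Decomposition D
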